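{- Let $k\in\mathbb{N}$, and let $k$ runners run clockwise along the circle $C=\mathbb{R}/\mathbb{Z}$ of length $1$ with constant rationally independent (thus distinct) speeds $\xi_1,\xi_2,\ldots,\xi_k>0$, starting from arbitrary points $\beta_1,\ldots,\beta_k\in C$. Then for every circular arc $A\subset C$ (of positive length) and for every $T>0$, there exists $t>T$ such that all $k$ runners are in $A$ at time $t$, i.e. $\xi_i t+\beta_i \bmod 1\in A$ for all $i=1,\ldots,k$.
   Context: $C=[0,1)\bmod 1=\mathbb{R}/\mathbb{Z}$ is the circle of length $1$. A circular arc of $C$ is the image in $\mathbb{R}/\mathbb{Z}$ of an interval of $\mathbb{R}$ of positive length at most $1$. A runner with constant speed $\xi>0$ and starting point $\beta\in C$ is at position $\xi t+\beta \bmod 1$ at time $t\ge 0$ (clockwise is the direction of increasing parameter). Real numbers $\xi_1,\ldots,\xi_k$ are rationally independent if no relation $c_1\xi_1+c_2\xi_2+\cdots+c_k\xi_k=0$ holds with integer coefficients $c_1,\ldots,c_k$ that are not all zero. -}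

module Defs where

open import Algebra.Bundles.Raw using (RawMonoid)
open import Data.Bool using (Bool; true; false)
open import Data.Fin using (Fin)
open import Data.Integer using (ℤ; 0ℤ)
open import Data.Nat as ℕ using (ℕ)
import Data.Nat.Properties as ℕ
open import Data.Product using (∃; _×_; _,_)
open import Data.Rational as ℚ using (ℚ; 0ℚ; 1ℚ; ½)
import Data.Rational.Properties as ℚ
open import Data.Rational.Solver using (module +-*-Solver)
open import Data.Vec.Functional using (Vector)
open import Level using (0ℓ)
open import Relation.Binary.PropositionalEquality
  using (_≡_; refl; sym; cong; cong₂; subst)
open import Relation.Nullary using (¬_)

------------------------------------------------------------------------
-- Real numbers: Cauchy sequences of rationals, considered up to _≃_

IsCauchy : (ℕ → ℚ) → Set
IsCauchy s = ∀ ε → 0ℚ ℚ.< ε →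
  ∃ λ N → ∀ m n → N ℕ.≤ m → N ℕ.≤ n → ℚ.∣ s m ℚ.- s n ∣ ℚ.< ε

record ℝ : Set where
  constructor mkℝ
  field
    seq    : ℕ → ℚ
    cauchy : IsCauchy seq

open ℝ public

infix  4 _≃_ _<_ _≤_
infixl 6 _+_
infixl 7 _*_

_≃_ : ℝ → ℝ → Set
x ≃ y = ∀ ε → 0ℚ ℚ.< ε →
  ∃ λ N → ∀ n → N ℕ.≤ n → ℚ.∣ seq x n ℚ.- seq y n ∣ ℚ.< ε

_<_ : ℝ → ℝ → Set
x < y = ∃ λ ε → 0ℚ ℚ.< ε ×
  ∃ λ N → ∀ n → N ℕ.≤ n → seq x n ℚ.+ ε ℚ.≤ seq y n

_≤_ : ℝ → ℝ → Set
x ≤ y = ¬ (y < x)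

fromℚ : ℚ → ℝ
fromℚ q = mkℝ (λ _ → q) λ ε 0<ε → 0 , λ _ _ _ _ →
  subst (λ d → ℚ.∣ d ∣ ℚ.< ε) (sym (ℚ.+-inverseʳ q)) 0<ε

fromℤ : ℤ → ℝ
fromℤ i = fromℚ (i ℚ./ 1)

0ℝ 1ℝ : ℝ
0ℝ = fromℚ 0ℚ
1ℝ = fromℚ 1ℚ

private
  +-rearrange : ∀ a b c d →
    (a ℚ.+ b) ℚ.- (c ℚ.+ d) ≡ (a ℚ.- c) ℚ.+ (b ℚ.- d)
  +-rearrange = solve 4
    (λ a b c d → (a :+ b) :+ (:- (c :+ d)) := (a :+ (:- c)) :+ (b :+ (:- d)))
    refl
    where open +-*-Solver

  *-rearrange : ∀ a b c d →
    a ℚ.* b ℚ.- c ℚ.* d ≡ a ℚ.* (b ℚ.- d) ℚ.+ (a ℚ.- c) ℚ.* d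
  *-rearrange = solve 4
    (λ a b c d → (a :* b) :+ (:- (c :* d))
              := (a :* (b :+ (:- d))) :+ ((a :+ (:- c)) :* d))
    refl
    where open +-*-Solver

  a-b+b : ∀ a b → (a ℚ.- b) ℚ.+ b ≡ a
  a-b+b = solve 2 (λ a b → (a :+ (:- b)) :+ b := a) refl
    where open +-*-Solver

  half+half : ∀ ε → ½ ℚ.* ε ℚ.+ ½ ℚ.* ε ≡ ε
  half+half = solve 1 (λ ε → (con ½ :* ε) :+ (con ½ :* ε) := ε) refl
    where open +-*-Solver

  0<½* : ∀ {ε} → 0ℚ ℚ.< ε → 0ℚ ℚ.< ½ ℚ.* ε
  0<½* {ε} 0<ε = subst (ℚ._< ½ ℚ.* ε) (ℚ.*-zeroʳ ½) (ℚ.*-monoʳ-<-pos ½ 0<ε)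

  0<* : ∀ {p q} → 0ℚ ℚ.< p → 0ℚ ℚ.< q → 0ℚ ℚ.< p ℚ.* q
  0<* {p} {q} 0<p 0<q =
    subst (ℚ._< p ℚ.* q) (ℚ.*-zeroʳ p)
      (ℚ.*-monoʳ-<-pos p {{ℚ.positive 0<p}} 0<q)

  *-mono : ∀ {p q r s} → 0ℚ ℚ.≤ p → p ℚ.≤ q → 0ℚ ℚ.≤ r → r ℚ.< s →
           0ℚ ℚ.< q → p ℚ.* r ℚ.< q ℚ.* s
  *-mono {p} {q} {r} {s} 0≤p p≤q 0≤r r<s 0<q = ℚ.≤-<-trans
    (ℚ.*-monoʳ-≤-nonNeg r {{ℚ.nonNegative 0≤r}} p≤q)
    (ℚ.*-monoʳ-<-pos q {{ℚ.positive 0<q}} r<s)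

  bounded : (x : ℝ) → ∃ λ B → 0ℚ ℚ.< B ×
            ∃ λ N → ∀ n → N ℕ.≤ n → ℚ.∣ seq x n ∣ ℚ.≤ B
  bounded x with cauchy x 1ℚ (ℚ.positive⁻¹ 1ℚ)
  ... | N , p = 1ℚ ℚ.+ ℚ.∣ seq x N ∣
              , ℚ.+-mono-<-≤ (ℚ.positive⁻¹ 1ℚ) (ℚ.0≤∣p∣ (seq x N))
              , N , λ n N≤n → begin
      ℚ.∣ seq x n ∣
        ≡⟨ cong ℚ.∣_∣ (a-b+b (seq x n) (seq x N)) ⟨
      ℚ.∣ (seq x n ℚ.- seq x N) ℚ.+ seq x N ∣
        ≤⟨ ℚ.∣p+q∣≤∣p∣+∣q∣ (seq x n ℚ.- seq x N) (seq x N) ⟩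
      ℚ.∣ seq x n ℚ.- seq x N ∣ ℚ.+ ℚ.∣ seq x N ∣
        ≤⟨ ℚ.+-monoˡ-≤ ℚ.∣ seq x N ∣ (ℚ.<⇒≤ (p n N N≤n ℕ.≤-refl)) ⟩
      1ℚ ℚ.+ ℚ.∣ seq x N ∣ ∎
    where open ℚ.≤-Reasoning

_+_ : ℝ → ℝ → ℝ
x + y = mkℝ (λ n → seq x n ℚ.+ seq y n) λ ε 0<ε →
  let M , p = cauchy x (½ ℚ.* ε) (0<½* 0<ε)
      N , q = cauchy y (½ ℚ.* ε) (0<½* 0<ε)
  in M ℕ.⊔ N , λ m n m≥ n≥ → begin-strict
    ℚ.∣ (seq x m ℚ.+ seq y m) ℚ.- (seq x n ℚ.+ seq y n) ∣
      ≡⟨ cong ℚ.∣_∣ (+-rearrange (seq x m) (seq y m) (seq x n) (seq y n)) ⟩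
    ℚ.∣ (seq x m ℚ.- seq x n) ℚ.+ (seq y m ℚ.- seq y n) ∣
      ≤⟨ ℚ.∣p+q∣≤∣p∣+∣q∣ (seq x m ℚ.- seq x n) (seq y m ℚ.- seq y n) ⟩
    ℚ.∣ seq x m ℚ.- seq x n ∣ ℚ.+ ℚ.∣ seq y m ℚ.- seq y n ∣
      <⟨ ℚ.+-mono-< (p m n (ℕ.m⊔n≤o⇒m≤o M N m≥) (ℕ.m⊔n≤o⇒m≤o M N n≥))
                    (q m n (ℕ.m⊔n≤o⇒n≤o M N m≥) (ℕ.m⊔n≤o⇒n≤o M N n≥)) ⟩
    ½ ℚ.* ε ℚ.+ ½ ℚ.* ε
      ≡⟨ half+half ε ⟩
    ε ∎
  where open ℚ.≤-Reasoning

_*_ : ℝ → ℝ → ℝ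
x * y = mkℝ (λ n → seq x n ℚ.* seq y n) λ ε 0<ε →
  let A , 0<A , K , a = bounded x
      B , 0<B , L , b = bounded y
      S   = A ℚ.+ B
      0<S = ℚ.+-mono-< 0<A 0<B
      instance
        S-pos : ℚ.Positive S
        S-pos = ℚ.positive 0<S
        S-nonZero : ℚ.NonZero S
        S-nonZero = ℚ.pos⇒nonZero S
      δ   = ℚ.1/ S ℚ.* ε
      0<δ = 0<* (ℚ.positive⁻¹ (ℚ.1/ S) {{ℚ.1/pos⇒pos S}}) 0<ε
      M , p = cauchy x δ 0<δ
      N , q = cauchy y δ 0<δ
      P = (K ℕ.⊔ L) ℕ.⊔ (M ℕ.⊔ N)
  in P , λ m n m≥ n≥ →
    let left  = λ {o} (h : P ℕ.≤ o) → ℕ.m⊔n≤o⇒m≤o (K ℕ.⊔ L) (M ℕ.⊔ N) h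
        right = λ {o} (h : P ℕ.≤ o) → ℕ.m⊔n≤o⇒n≤o (K ℕ.⊔ L) (M ℕ.⊔ N) h
        dx = seq x m ℚ.- seq x n
        dy = seq y m ℚ.- seq y n
        ∣dx∣<δ = p m n (ℕ.m⊔n≤o⇒m≤o M N (right m≥)) (ℕ.m⊔n≤o⇒m≤o M N (right n≥))
        ∣dy∣<δ = q m n (ℕ.m⊔n≤o⇒n≤o M N (right m≥)) (ℕ.m⊔n≤o⇒n≤o M N (right n≥))
    in begin-strict
    ℚ.∣ seq x m ℚ.* seq y m ℚ.- seq x n ℚ.* seq y n ∣
      ≡⟨ cong ℚ.∣_∣ (*-rearrange (seq x m) (seq y m) (seq x n) (seq y n)) ⟩
    ℚ.∣ seq x m ℚ.* dy ℚ.+ dx ℚ.* seq y n ∣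
      ≤⟨ ℚ.∣p+q∣≤∣p∣+∣q∣ (seq x m ℚ.* dy) (dx ℚ.* seq y n) ⟩
    ℚ.∣ seq x m ℚ.* dy ∣ ℚ.+ ℚ.∣ dx ℚ.* seq y n ∣
      ≡⟨ cong₂ ℚ._+_ (ℚ.∣p*q∣≡∣p∣*∣q∣ (seq x m) dy)
           (ℚ.∣p*q∣≡∣p∣*∣q∣ dx (seq y n)) ⟩
    ℚ.∣ seq x m ∣ ℚ.* ℚ.∣ dy ∣ ℚ.+ ℚ.∣ dx ∣ ℚ.* ℚ.∣ seq y n ∣
      ≡⟨ cong (ℚ.∣ seq x m ∣ ℚ.* ℚ.∣ dy ∣ ℚ.+_)
           (ℚ.*-comm ℚ.∣ dx ∣ ℚ.∣ seq y n ∣) ⟩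
    ℚ.∣ seq x m ∣ ℚ.* ℚ.∣ dy ∣ ℚ.+ ℚ.∣ seq y n ∣ ℚ.* ℚ.∣ dx ∣
      <⟨ ℚ.+-mono-<
           (*-mono (ℚ.0≤∣p∣ (seq x m)) (a m (ℕ.m⊔n≤o⇒m≤o K L (left m≥)))
                   (ℚ.0≤∣p∣ dy) ∣dy∣<δ 0<A)
           (*-mono (ℚ.0≤∣p∣ (seq y n)) (b n (ℕ.m⊔n≤o⇒n≤o K L (left n≥)))
                   (ℚ.0≤∣p∣ dx) ∣dx∣<δ 0<B) ⟩
    A ℚ.* δ ℚ.+ B ℚ.* δ
      ≡⟨ ℚ.*-distribʳ-+ δ A B ⟨
    S ℚ.* (ℚ.1/ S ℚ.* ε)
      ≡⟨ ℚ.*-assoc S (ℚ.1/ S) ε ⟨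
    (S ℚ.* ℚ.1/ S) ℚ.* ε
      ≡⟨ cong (ℚ._* ε) (ℚ.*-inverseʳ S) ⟩
    1ℚ ℚ.* ε
      ≡⟨ ℚ.*-identityˡ ε ⟩
    ε ∎
  where open ℚ.≤-Reasoning

+-0-rawMonoid : RawMonoid 0ℓ 0ℓ
+-0-rawMonoid = record { Carrier = ℝ ; _≈_ = _≃_ ; _∙_ = _+_ ; ε = 0ℝ }

open import Algebra.Definitions.RawMonoid +-0-rawMonoid public using (sum)

-- Read classically.  Without excluded middle, a combination that is not
-- ≃ 0ℝ need not be bounded away from 0.

RationallyIndependent : ∀ {k} → Vector ℝ k → Set
RationallyIndependent {k} ξ =
  ¬ ∃ λ (c : Fin k → ℤ) →
      ¬ (∀ i → c i ≡ 0ℤ) × sum (λ i → fromℤ (c i) * ξ i) ≃ 0ℝ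

------------------------------------------------------------------------
-- The circle ℝ/ℤ: its points are given by real representatives, and
-- equality of points is _≈ᶜ_

Circle : Set
Circle = ℝ

infix 4 _≈ᶜ_ _∈ᴵ_ _∈_

_≈ᶜ_ : Circle → Circle → Set
p ≈ᶜ q = ∃ λ (n : ℤ) → p ≃ q + fromℤ n

position : (speed : ℝ) (start : Circle) (time : ℝ) → Circle
position ξ β t = ξ * t + β

-- The flags say whether an endpoint belongs to the interval, so that
-- open, closed and half-open intervals are all covered.

record Interval : Set where
  field
    lower upper             : ℝ
    lowerClosed upperClosed : Bool

-- bound true is _≤_ and bound false is _<_.

bound : Bool → ℝ → ℝ → Set
bound true  x y = x ≤ y
bound false x y = x < y

_∈ᴵ_ : ℝ → Interval → Set
x ∈ᴵ I = bound lowerClosed lower x × bound upperClosed x upper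
  where open Interval I

record Arc : Set where
  field
    interval : Interval

  open Interval interval public

  field
    length-positive : lower < upper
    length-at-most1 : upper ≤ lower + 1ℝ

-- Membership in the image of the interval under ℝ → ℝ/ℤ.

_∈_ : Circle → Arc → Set
p ∈ A = ∃ λ x → x ∈ᴵ Arc.interval A × x ≈ᶜ p

{-# OPTIONS --safe #-}
module Submission where

-- Kronecker's theorem by Estermann's induction on the number of speeds.  By Dirichlet's theorem
-- there are integers s > 0 and bᵢ making all ψᵢ = s ξᵢ / ξ₀ − bᵢ (i ≥ 1) small, and the ψᵢ are
-- again independent.  By induction some t brings all t ψᵢ close to αᵢ − α₀ ξᵢ / ξ₀ modulo 1.
-- Since the ψᵢ are small, t may be rounded to an integer m, and then the time (m s + α₀) / ξ₀
-- brings every ξᵢ close to αᵢ.  A further application of Dirichlet's theorem to multiples of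
-- the speeds yields a large time at which all runners are almost back where they were, so the
-- meeting time can be moved beyond T.

open import Defs
open import Axiom.ExcludedMiddle using (ExcludedMiddle)
open import Data.Bool using (Bool; true; false)
open import Data.Fin as Fin using (Fin)
import Data.Fin.Properties as Fin
open import Data.Integer as ℤ using (ℤ; 0ℤ; 1ℤ)
import Data.Integer.DivMod as ℤ
import Data.Integer.Properties as ℤ
import Data.Integer.Solver as ℤ
open import Data.Nat as ℕ using (ℕ; suc)
import Data.Nat.Properties as ℕ
open import Data.Product using (∃; ∃₂; _×_; _,_; proj₁; proj₂)
open import Data.Rational as ℚ using (ℚ; 0ℚ; 1ℚ; ½)
import Data.Rational.Properties as ℚ
open import Data.Rational.Solver using (module +-*-Solver)
import Data.Rational.Unnormalised as ℚᵘ
import Data.Rational.Unnormalised.Properties as ℚᵘ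
open import Data.Sum using (inj₁; inj₂)
open import Data.Vec.Functional as Vector using (Vector)
open import Function using (_∘_)
open import Level using (0ℓ)
open import Relation.Binary.PropositionalEquality
  using (_≡_; _≢_; refl; sym; trans; cong; cong₂; subst; subst₂; module ≡-Reasoning)
open import Relation.Nullary using (¬_; yes; no; contradiction)
open import Relation.Nullary.Decidable using (decidable-stable)

open +-*-Solver using (solve; _:=_; _:+_; _:*_; _:-_; :-_; con)

-- The integers as an ordered subring of the rationals.

ι : ℤ → ℚ
ι i = i ℚ./ 1

-- The normalised fraction `i / 1` does not reduce for a variable `i`. Its unnormalised form
-- `mkℚᵘ i 0` has arithmetic that computes, so the ring and order properties of `ι` are checked
-- there and carried back.
toℚᵘ-ι : ∀ i → ℚ.toℚᵘ (ι i) ℚᵘ.≃ ℚᵘ.mkℚᵘ i 0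
toℚᵘ-ι i = ℚ.toℚᵘ-fromℚᵘ (ℚᵘ.mkℚᵘ i 0)

ι-homo-+ : ∀ i j → ι (i ℤ.+ j) ≡ ι i ℚ.+ ι j
ι-homo-+ i j = ℚ.toℚᵘ-injective (begin
  ℚ.toℚᵘ (ι (i ℤ.+ j))               ≈⟨ toℚᵘ-ι (i ℤ.+ j) ⟩
  ℚᵘ.mkℚᵘ (i ℤ.+ j) 0                ≈⟨ ℚᵘ.*≡* (cong₂ (λ k l → (k ℤ.+ l) ℤ.* 1ℤ)
                                          (sym (ℤ.*-identityʳ i)) (sym (ℤ.*-identityʳ j))) ⟩
  ℚᵘ.mkℚᵘ i 0 ℚᵘ.+ ℚᵘ.mkℚᵘ j 0       ≈⟨ ℚᵘ.+-cong (toℚᵘ-ι i) (toℚᵘ-ι j) ⟨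
  ℚ.toℚᵘ (ι i) ℚᵘ.+ ℚ.toℚᵘ (ι j)     ≈⟨ ℚ.toℚᵘ-homo-+ (ι i) (ι j) ⟨
  ℚ.toℚᵘ (ι i ℚ.+ ι j)               ∎)
  where open ℚᵘ.≃-Reasoning

ι-homo-* : ∀ i j → ι (i ℤ.* j) ≡ ι i ℚ.* ι j
ι-homo-* i j = ℚ.toℚᵘ-injective (begin
  ℚ.toℚᵘ (ι (i ℤ.* j))               ≈⟨ toℚᵘ-ι (i ℤ.* j) ⟩
  ℚᵘ.mkℚᵘ i 0 ℚᵘ.* ℚᵘ.mkℚᵘ j 0       ≈⟨ ℚᵘ.*-cong (toℚᵘ-ι i) (toℚᵘ-ι j) ⟨
  ℚ.toℚᵘ (ι i) ℚᵘ.* ℚ.toℚᵘ (ι j)     ≈⟨ ℚ.toℚᵘ-homo-* (ι i) (ι j) ⟨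
  ℚ.toℚᵘ (ι i ℚ.* ι j)               ∎)
  where open ℚᵘ.≃-Reasoning

ι-homo-neg : ∀ i → ι (ℤ.- i) ≡ ℚ.- ι i
ι-homo-neg i = ℚ.toℚᵘ-injective (begin
  ℚ.toℚᵘ (ι (ℤ.- i))       ≈⟨ toℚᵘ-ι (ℤ.- i) ⟩
  ℚᵘ.- ℚᵘ.mkℚᵘ i 0         ≈⟨ ℚᵘ.-‿cong (toℚᵘ-ι i) ⟨
  ℚᵘ.- ℚ.toℚᵘ (ι i)        ≈⟨ ℚ.toℚᵘ-homo‿- (ι i) ⟨
  ℚ.toℚᵘ (ℚ.- ι i)         ∎)
  where open ℚᵘ.≃-Reasoning

ι-homo-- : ∀ i j → ι (i ℤ.- j) ≡ ι i ℚ.- ι j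
ι-homo-- i j = trans (ι-homo-+ i (ℤ.- j)) (cong (ι i ℚ.+_) (ι-homo-neg j))

ι-mono-≤ : ∀ {i j} → i ℤ.≤ j → ι i ℚ.≤ ι j
ι-mono-≤ {i} {j} i≤j = ℚ.toℚᵘ-cancel-≤ (begin
  ℚ.toℚᵘ (ι i)    ≃⟨ toℚᵘ-ι i ⟩
  ℚᵘ.mkℚᵘ i 0     ≤⟨ ℚᵘ.*≤* (ℤ.*-monoʳ-≤-nonNeg 1ℤ i≤j) ⟩
  ℚᵘ.mkℚᵘ j 0     ≃⟨ toℚᵘ-ι j ⟨
  ℚ.toℚᵘ (ι j)    ∎)
  where open ℚᵘ.≤-Reasoning

ι-mono-< : ∀ {i j} → i ℤ.< j → ι i ℚ.< ι j
ι-mono-< {i} {j} i<j = ℚ.toℚᵘ-cancel-< (begin-strict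
  ℚ.toℚᵘ (ι i)    ≃⟨ toℚᵘ-ι i ⟩
  ℚᵘ.mkℚᵘ i 0     <⟨ ℚᵘ.*<* (ℤ.*-monoʳ-<-pos 1ℤ i<j) ⟩
  ℚᵘ.mkℚᵘ j 0     ≃⟨ toℚᵘ-ι j ⟨
  ℚ.toℚᵘ (ι j)    ∎)
  where open ℚᵘ.≤-Reasoning

-- The floor of a rational.

p*↧p≡↥p : ∀ p → p ℚ.* ι (ℚ.↧ p) ≡ ι (ℚ.↥ p)
p*↧p≡↥p p@record{} = ℚ.toℚᵘ-injective (begin
  ℚ.toℚᵘ (p ℚ.* ι (ℚ.↧ p))            ≈⟨ ℚ.toℚᵘ-homo-* p (ι (ℚ.↧ p)) ⟩
  ℚ.toℚᵘ p ℚᵘ.* ℚ.toℚᵘ (ι (ℚ.↧ p))      ≈⟨ ℚᵘ.*-congˡ {ℚ.toℚᵘ p} (toℚᵘ-ι (ℚ.↧ p)) ⟩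
  ℚ.toℚᵘ p ℚᵘ.* ℚᵘ.mkℚᵘ (ℚ.↧ p) 0     ≈⟨ ℚᵘ.*≡* (trans (ℤ.*-identityʳ (ℚ.↥ p ℤ.* ℚ.↧ p))
                                           (cong (λ d → ℚ.↥ p ℤ.* ℤ.+ d) (sym (ℕ.*-identityʳ (ℚ.↧ₙ p))))) ⟩
  ℚᵘ.mkℚᵘ (ℚ.↥ p) 0                   ≈⟨ toℚᵘ-ι (ℚ.↥ p) ⟨
  ℚ.toℚᵘ (ι (ℚ.↥ p))                    ∎)
  where open ℚᵘ.≃-Reasoning

-- Multiplied by the denominator `d`, the difference becomes the remainder `r` of the numerator
-- modulo `d`, and 0 ≤ r < d.
∣p-⌊p⌋∣<1 : ∀ p → ℚ.∣ p ℚ.- ι (ℚ.floor p) ∣ ℚ.< 1ℚ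
∣p-⌊p⌋∣<1 p@record{} = ℚ.*-cancelʳ-<-nonNeg d {{ℚ.pos⇒nonNeg d}} (begin-strict
  ℚ.∣ p ℚ.- f ∣ ℚ.* d          ≡⟨ cong (ℚ.∣ p ℚ.- f ∣ ℚ.*_) (ℚ.0≤p⇒∣p∣≡p 0≤d) ⟨
  ℚ.∣ p ℚ.- f ∣ ℚ.* ℚ.∣ d ∣    ≡⟨ ℚ.∣p*q∣≡∣p∣*∣q∣ (p ℚ.- f) d ⟨
  ℚ.∣ (p ℚ.- f) ℚ.* d ∣        ≡⟨ cong ℚ.∣_∣ [p-f]*d≡ιr ⟩
  ℚ.∣ ι r ∣                    ≡⟨ ℚ.0≤p⇒∣p∣≡p (ι-mono-≤ {0ℤ} {r} (ℤ.+≤+ ℕ.z≤n)) ⟩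
  ι r                          <⟨ ι-mono-< {r} {ℚ.↧ p} (ℤ.+<+ (ℤ.n%d<d (ℚ.↥ p) (ℚ.↧ p))) ⟩
  d                            ≡⟨ ℚ.*-identityˡ d ⟨
  1ℚ ℚ.* d                     ∎)
  where
  open ℚ.≤-Reasoning
  f = ι (ℚ.floor p)
  d = ι (ℚ.↧ p)
  r = ℤ.+ (ℚ.↥ p ℤ.% ℚ.↧ p)
  instance
    d-pos : ℚ.Positive d
    d-pos = ℚ.positive (ι-mono-< {0ℤ} {ℚ.↧ p} (ℤ.positive⁻¹ (ℚ.↧ p)))
  0≤d : 0ℚ ℚ.≤ d
  0≤d = ℚ.<⇒≤ (ℚ.positive⁻¹ d)
  [p-f]*d≡ιr : (p ℚ.- f) ℚ.* d ≡ ι r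
  [p-f]*d≡ιr = begin-equality
    (p ℚ.- f) ℚ.* d                           ≡⟨ ℚ.*-distribʳ-+ d p (ℚ.- f) ⟩
    p ℚ.* d ℚ.+ (ℚ.- f) ℚ.* d                 ≡⟨ cong (ℚ._+ (ℚ.- f) ℚ.* d) (begin-equality
      p ℚ.* d                                   ≡⟨ p*↧p≡↥p p ⟩
      ι (ℚ.↥ p)                                 ≡⟨ cong ι (ℤ.a≡a%n+[a/n]*n (ℚ.↥ p) (ℚ.↧ p)) ⟩
      ι (r ℤ.+ ℚ.floor p ℤ.* ℚ.↧ p)             ≡⟨ ι-homo-+ r (ℚ.floor p ℤ.* ℚ.↧ p) ⟩
      ι r ℚ.+ ι (ℚ.floor p ℤ.* ℚ.↧ p)           ≡⟨ cong (ι r ℚ.+_) (ι-homo-* (ℚ.floor p) (ℚ.↧ p)) ⟩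
      ι r ℚ.+ f ℚ.* d                           ∎) ⟩
    (ι r ℚ.+ f ℚ.* d) ℚ.+ (ℚ.- f) ℚ.* d
      ≡⟨ solve 3 (λ r f d → (r :+ f :* d) :+ (:- f) :* d := r) refl (ι r) f d ⟩
    ι r                                       ∎

-- Absolute values and the Archimedean property.

p≤∣p∣ : ∀ p → p ℚ.≤ ℚ.∣ p ∣
p≤∣p∣ p with ℚ.≤-total 0ℚ p
... | inj₁ 0≤p = ℚ.≤-reflexive (sym (ℚ.0≤p⇒∣p∣≡p 0≤p))
... | inj₂ p≤0 = ℚ.≤-trans p≤0 (ℚ.0≤∣p∣ p)

∣p-q∣≡∣q-p∣ : ∀ p q → ℚ.∣ p ℚ.- q ∣ ≡ ℚ.∣ q ℚ.- p ∣
∣p-q∣≡∣q-p∣ p q = trans (sym (ℚ.∣-p∣≡∣p∣ (p ℚ.- q)))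
  (cong ℚ.∣_∣ (solve 2 (λ p q → :- (p :- q) := q :- p) refl p q))

∣p-q∣<r⇒p<q+r : ∀ p q {r} → ℚ.∣ p ℚ.- q ∣ ℚ.< r → p ℚ.< q ℚ.+ r
∣p-q∣<r⇒p<q+r p q {r} h = begin-strict
  p                        ≡⟨ solve 2 (λ p q → p := q :+ (p :- q)) refl p q ⟩
  q ℚ.+ (p ℚ.- q)          ≤⟨ ℚ.+-monoʳ-≤ q (p≤∣p∣ (p ℚ.- q)) ⟩
  q ℚ.+ ℚ.∣ p ℚ.- q ∣      <⟨ ℚ.+-monoʳ-< q h ⟩
  q ℚ.+ r                  ∎
  where open ℚ.≤-Reasoning

∣p-q∣<r⇒q<p+r : ∀ p q {r} → ℚ.∣ p ℚ.- q ∣ ℚ.< r → q ℚ.< p ℚ.+ r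
∣p-q∣<r⇒q<p+r p q {r} h =
  ∣p-q∣<r⇒p<q+r q p (subst (ℚ._< r) (∣p-q∣≡∣q-p∣ p q) h)

∣+∣-mono-< : ∀ {p q r s} → ℚ.∣ p ∣ ℚ.< r → ℚ.∣ q ∣ ℚ.< s → ℚ.∣ p ℚ.+ q ∣ ℚ.< r ℚ.+ s
∣+∣-mono-< {p} {q} p<r q<s = ℚ.≤-<-trans (ℚ.∣p+q∣≤∣p∣+∣q∣ p q) (ℚ.+-mono-< p<r q<s)

∣-∣-mono-< : ∀ {p q r s} → ℚ.∣ p ∣ ℚ.< r → ℚ.∣ q ∣ ℚ.< s → ℚ.∣ p ℚ.- q ∣ ℚ.< r ℚ.+ s
∣-∣-mono-< {p} {q} p<r q<s = ℚ.≤-<-trans (ℚ.∣p-q∣≤∣p∣+∣q∣ p q) (ℚ.+-mono-< p<r q<s)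

∣*∣-mono-< : ∀ {p q r s} → ℚ.∣ p ∣ ℚ.< r → ℚ.∣ q ∣ ℚ.< s → ℚ.∣ p ℚ.* q ∣ ℚ.< r ℚ.* s
∣*∣-mono-< {p} {q} {r} {s} p<r q<s = begin-strict
  ℚ.∣ p ℚ.* q ∣           ≡⟨ ℚ.∣p*q∣≡∣p∣*∣q∣ p q ⟩
  ℚ.∣ p ∣ ℚ.* ℚ.∣ q ∣     ≤⟨ ℚ.*-monoʳ-≤-nonNeg ℚ.∣ q ∣ {{ℚ.∣-∣-nonNeg q}} (ℚ.<⇒≤ p<r) ⟩
  r ℚ.* ℚ.∣ q ∣           <⟨ ℚ.*-monoʳ-<-pos r {{ℚ.positive (ℚ.≤-<-trans (ℚ.0≤∣p∣ p) p<r)}} q<s ⟩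
  r ℚ.* s                 ∎
  where open ℚ.≤-Reasoning

0<p*q : ∀ {p q} → 0ℚ ℚ.< p → 0ℚ ℚ.< q → 0ℚ ℚ.< p ℚ.* q
0<p*q {p} {q} 0<p 0<q =
  ℚ.positive⁻¹ (p ℚ.* q) {{ℚ.pos*pos⇒pos p {{ℚ.positive 0<p}} q {{ℚ.positive 0<q}}}}

i≤+∣i∣ : ∀ i → i ℤ.≤ ℤ.+ ℤ.∣ i ∣
i≤+∣i∣ (ℤ.+ n)    = ℤ.≤-refl
i≤+∣i∣ ℤ.-[1+ n ] = ℤ.-≤+

-- Opaque to keep type checking from unfolding integer division.
opaque
  integerPart : ∀ p → ∃ λ z → ℚ.∣ p ℚ.- ι z ∣ ℚ.< 1ℚ
  integerPart p = ℚ.floor p , ∣p-⌊p⌋∣<1 p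

-- With `z` the integer part of p / ε, p / ε < z + 1 ≤ ∣z∣ + 1. The form `suc q` makes the
-- multiplier positive whatever the sign of `p`, so it can serve as a modulus or as a positive time.
archimedean : ∀ p {ε} → 0ℚ ℚ.< ε → ∃ λ q → p ℚ.≤ ι (ℤ.+ suc q) ℚ.* ε
archimedean p {ε} 0<ε = ℤ.∣ z ∣ , (begin
  p                              ≡⟨ ℚ.*-identityʳ p ⟨
  p ℚ.* 1ℚ                       ≡⟨ cong (p ℚ.*_) (ℚ.*-inverseˡ ε) ⟨
  p ℚ.* (ℚ.1/ ε ℚ.* ε)           ≡⟨ ℚ.*-assoc p (ℚ.1/ ε) ε ⟨
  r ℚ.* ε                        ≤⟨ ℚ.*-monoʳ-≤-nonNeg ε {{ℚ.pos⇒nonNeg ε}} r≤ ⟩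
  ι (ℤ.+ suc ℤ.∣ z ∣) ℚ.* ε      ∎)
  where
  open ℚ.≤-Reasoning
  instance
    ε-pos : ℚ.Positive ε
    ε-pos = ℚ.positive 0<ε
    ε-nonZero : ℚ.NonZero ε
    ε-nonZero = ℚ.pos⇒nonZero ε
  r = p ℚ.* ℚ.1/ ε
  z = proj₁ (integerPart r)
  r≤ : r ℚ.≤ ι (ℤ.+ suc ℤ.∣ z ∣)
  r≤ = begin
    r                             ≤⟨ ℚ.<⇒≤ (∣p-q∣<r⇒p<q+r r (ι z) (proj₂ (integerPart r))) ⟩
    ι z ℚ.+ 1ℚ                    ≤⟨ ℚ.+-monoˡ-≤ 1ℚ (ι-mono-≤ {z} {ℤ.+ ℤ.∣ z ∣} (i≤+∣i∣ z)) ⟩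
    ι (ℤ.+ ℤ.∣ z ∣) ℚ.+ 1ℚ        ≡⟨ ℚ.+-comm (ι (ℤ.+ ℤ.∣ z ∣)) 1ℚ ⟩
    1ℚ ℚ.+ ι (ℤ.+ ℤ.∣ z ∣)        ≡⟨ ι-homo-+ 1ℤ (ℤ.+ ℤ.∣ z ∣) ⟨
    ι (ℤ.+ suc ℤ.∣ z ∣)           ∎

-- Approximation of reals on tails of their sequences.

Eventually : (ℕ → Set) → Set
Eventually P = ∃ λ N → ∀ n → N ℕ.≤ n → P n

always : ∀ {P : ℕ → Set} → (∀ n → P n) → Eventually P
always p = 0 , λ n _ → p n

map : ∀ {P Q : ℕ → Set} → (∀ n → P n → Q n) → Eventually P → Eventually Q
map f (M , p) = M , λ n M≤n → f n (p n M≤n)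

map₂ : ∀ {P Q R : ℕ → Set} → (∀ n → P n → Q n → R n) →
       Eventually P → Eventually Q → Eventually R
map₂ f (M , p) (N , q) = M ℕ.⊔ N , λ n h →
  f n (p n (ℕ.m⊔n≤o⇒m≤o M N h)) (q n (ℕ.m⊔n≤o⇒n≤o M N h))

infix 4 _≈[_]_

-- This is `_≃_` at one fixed tolerance. Between the real limits it gives only distance ≤ ε, but
-- being a statement about terms it turns every estimate below into one about rationals at a single
-- index.
_≈[_]_ : ℝ → ℚ → ℝ → Set
x ≈[ ε ] y = Eventually λ n → ℚ.∣ seq x n ℚ.- seq y n ∣ ℚ.< ε

approximate : ∀ x {ε} → 0ℚ ℚ.< ε → ∃ λ q → x ≈[ ε ] fromℚ q
approximate x {ε} 0<ε with N , p ← cauchy x ε 0<ε =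
  seq x N , N , λ n N≤n → p n N N≤n ℕ.≤-refl

2ℚ : ℚ
2ℚ = 1ℚ ℚ.+ 1ℚ

-- One unit of the tolerance pays for replacing `x` by a rational, the other for taking the integer
-- part of that rational.
nearbyInteger : ∀ x → ∃ λ z → x ≈[ 2ℚ ] fromℤ z
nearbyInteger x with q , x≈q ← approximate x (ℚ.positive⁻¹ 1ℚ) with z , q≈z ← integerPart q =
  z , map (λ n h → subst (ℚ._< 2ℚ)
    (cong ℚ.∣_∣ (solve 3 (λ x q z → (x :- q) :+ (q :- z) := x :- z) refl (seq x n) q (ι z)))
    (∣+∣-mono-< h q≈z)) x≈q

bounded-above : ∀ x → ∃ λ B → Eventually λ n → seq x n ℚ.≤ B
bounded-above x with q , x≈q ← approximate x (ℚ.positive⁻¹ 1ℚ) =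
  q ℚ.+ 1ℚ , map (λ n h → ℚ.<⇒≤ (∣p-q∣<r⇒p<q+r (seq x n) q h)) x≈q

-- Dirichlet's simultaneous approximation.

%-≡⇒-≡*[/-/] : ∀ i j d .{{_ : ℤ.NonZero d}} → i ℤ.% d ≡ j ℤ.% d →
  i ℤ.- j ≡ (i ℤ./ d ℤ.- j ℤ./ d) ℤ.* d
%-≡⇒-≡*[/-/] i j d i%d≡j%d = begin
  i ℤ.- j
    ≡⟨ cong₂ ℤ._-_ (ℤ.a≡a%n+[a/n]*n i d) (ℤ.a≡a%n+[a/n]*n j d) ⟩
  (ℤ.+ (i ℤ.% d) ℤ.+ a ℤ.* d) ℤ.- (ℤ.+ (j ℤ.% d) ℤ.+ b ℤ.* d)
    ≡⟨ cong (λ r → (ℤ.+ r ℤ.+ a ℤ.* d) ℤ.- (ℤ.+ (j ℤ.% d) ℤ.+ b ℤ.* d)) i%d≡j%d ⟩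
  (ℤ.+ (j ℤ.% d) ℤ.+ a ℤ.* d) ℤ.- (ℤ.+ (j ℤ.% d) ℤ.+ b ℤ.* d)
    ≡⟨ S.solve 4 (λ r a b d → (r S.:+ a S.:* d) S.:- (r S.:+ b S.:* d) S.:= (a S.:- b) S.:* d)
         refl (ℤ.+ (j ℤ.% d)) a b d ⟩
  (a ℤ.- b) ℤ.* d ∎
  where
  open ≡-Reasoning
  module S = ℤ.+-*-Solver
  a = i ℤ./ d
  b = j ℤ./ d

-- Because `zⱼ` and `zᵢ` differ by b q, the quantity q ((j - i) x - b) is the difference of the two
-- rounding errors, hence below 2 r ≤ q ε; then `q` cancels.
sameCell⇒close : ∀ {q j i x zⱼ zᵢ b r ε} → 0ℚ ℚ.< q →
  zⱼ ℚ.- zᵢ ≡ b ℚ.* q → r ℚ.+ r ℚ.≤ q ℚ.* ε →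
  ℚ.∣ q ℚ.* j ℚ.* x ℚ.- zⱼ ∣ ℚ.< r → ℚ.∣ q ℚ.* i ℚ.* x ℚ.- zᵢ ∣ ℚ.< r →
  ℚ.∣ (j ℚ.- i) ℚ.* x ℚ.- b ∣ ℚ.< ε
sameCell⇒close {q} {j} {i} {x} {zⱼ} {zᵢ} {b} {r} {ε} 0<q z-z 2r≤qε hⱼ hᵢ =
  ℚ.*-cancelˡ-<-nonNeg q {{ℚ.nonNegative (ℚ.<⇒≤ 0<q)}} (begin-strict
    q ℚ.* ℚ.∣ v ∣           ≡⟨ cong (ℚ._* ℚ.∣ v ∣) (ℚ.0≤p⇒∣p∣≡p (ℚ.<⇒≤ 0<q)) ⟨
    ℚ.∣ q ∣ ℚ.* ℚ.∣ v ∣     ≡⟨ ℚ.∣p*q∣≡∣p∣*∣q∣ q v ⟨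
    ℚ.∣ q ℚ.* v ∣           ≡⟨ cong ℚ.∣_∣ qv ⟩
    ℚ.∣ (q ℚ.* j ℚ.* x ℚ.- zⱼ) ℚ.- (q ℚ.* i ℚ.* x ℚ.- zᵢ) ∣  <⟨ ∣-∣-mono-< hⱼ hᵢ ⟩
    r ℚ.+ r                 ≤⟨ 2r≤qε ⟩
    q ℚ.* ε                 ∎)
  where
  open ℚ.≤-Reasoning
  v = (j ℚ.- i) ℚ.* x ℚ.- b
  qv : q ℚ.* v ≡ (q ℚ.* j ℚ.* x ℚ.- zⱼ) ℚ.- (q ℚ.* i ℚ.* x ℚ.- zᵢ)
  qv = begin-equality
    q ℚ.* v
      ≡⟨ solve 5 (λ q j i x b → q :* ((j :- i) :* x :- b) := q :* j :* x :- q :* i :* x :- b :* q)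
           refl q j i x b ⟩
    q ℚ.* j ℚ.* x ℚ.- q ℚ.* i ℚ.* x ℚ.- b ℚ.* q
      ≡⟨ cong (λ c → q ℚ.* j ℚ.* x ℚ.- q ℚ.* i ℚ.* x ℚ.- c) z-z ⟨
    q ℚ.* j ℚ.* x ℚ.- q ℚ.* i ℚ.* x ℚ.- (zⱼ ℚ.- zᵢ)
      ≡⟨ solve 4 (λ a b c d → a :- b :- (c :- d) := (a :- c) :- (b :- d))
           refl (q ℚ.* j ℚ.* x) (q ℚ.* i ℚ.* x) zⱼ zᵢ ⟩
    (q ℚ.* j ℚ.* x ℚ.- zⱼ) ℚ.- (q ℚ.* i ℚ.* x ℚ.- zᵢ) ∎

-- Pigeonhole on the residues mod Q of the integers near Q j xₘ, for 0 ≤ j ≤ Qᵏ: if i and j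
-- agree in all of them, then Q (j − i) xₘ is within 4 ≤ Q ε of a multiple of Q.
dirichlet-pigeonhole : ∀ {k} (x : Vector ℝ k) {ε} q → 2ℚ ℚ.+ 2ℚ ℚ.≤ ι (ℤ.+ suc q) ℚ.* ε →
  ∃₂ λ (s : ℤ) (b : Fin k → ℤ) → 0ℤ ℤ.< s × (∀ i → fromℤ s * x i ≈[ ε ] fromℤ (b i))
dirichlet-pigeonhole {k} x {ε} q 4≤Qε =
  close-pair (Fin.pigeonhole (ℕ.n<1+n (suc q ℕ.^ k)) λ j → Fin.funToFin (cell j))
  where
  Q = ℤ.+ suc q

  near : ∀ j m → ∃ λ z → fromℤ Q * fromℤ (ℤ.+ j) * x m ≈[ 2ℚ ] fromℤ z
  near j m = nearbyInteger (fromℤ Q * fromℤ (ℤ.+ j) * x m)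

  z : ℕ → Fin k → ℤ
  z j m = proj₁ (near j m)

  -- The residue of `z` modulo Q stands in for the index of the cell of length 1 / Q containing the
  -- fractional part of j xₘ. As `z` only has to be within 2 of Q j xₘ, no real is compared with a
  -- cell boundary.
  cell : Fin (suc (suc q ℕ.^ k)) → Fin k → Fin (suc q)
  cell j m = Fin.fromℕ< (ℤ.n%d<d (z (Fin.toℕ j) m) Q)

  close-pair : (∃₂ λ i j → i Fin.< j × Fin.funToFin (cell i) ≡ Fin.funToFin (cell j)) →
    ∃₂ λ (s : ℤ) (b : Fin k → ℤ) → 0ℤ ℤ.< s × (∀ i → fromℤ s * x i ≈[ ε ] fromℤ (b i))
  close-pair (i , j , i<j , eq) =
    J ℤ.- I , b , subst (ℤ._< J ℤ.- I) (ℤ.+-inverseʳ I) (ℤ.+-monoˡ-< (ℤ.- I) (ℤ.+<+ i<j)) ,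
    λ m → map₂ (close m) (proj₂ (near (Fin.toℕ j) m)) (proj₂ (near (Fin.toℕ i) m))
    where
    I = ℤ.+ Fin.toℕ i
    J = ℤ.+ Fin.toℕ j
    zi = z (Fin.toℕ i)
    zj = z (Fin.toℕ j)

    b : Fin k → ℤ
    b m = zj m ℤ./ Q ℤ.- zi m ℤ./ Q

    sameCell : ∀ m → cell j m ≡ cell i m
    sameCell m = trans (sym (Fin.finToFun-funToFin (cell j) m))
      (trans (cong (λ c → Fin.finToFun c m) (sym eq)) (Fin.finToFun-funToFin (cell i) m))

    z-z : ∀ m → ι (zj m) ℚ.- ι (zi m) ≡ ι (b m) ℚ.* ι Q
    z-z m = begin
      ι (zj m) ℚ.- ι (zi m)    ≡⟨ ι-homo-- (zj m) (zi m) ⟨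
      ι (zj m ℤ.- zi m)        ≡⟨ cong ι (%-≡⇒-≡*[/-/] (zj m) (zi m) Q
                                    (Fin.fromℕ<-injective _ _ _ _ (sameCell m))) ⟩
      ι (b m ℤ.* Q)            ≡⟨ ι-homo-* (b m) Q ⟩
      ι (b m) ℚ.* ι Q          ∎
      where open ≡-Reasoning

    close : ∀ m n →
      ℚ.∣ ι Q ℚ.* ι J ℚ.* seq (x m) n ℚ.- ι (zj m) ∣ ℚ.< 2ℚ →
      ℚ.∣ ι Q ℚ.* ι I ℚ.* seq (x m) n ℚ.- ι (zi m) ∣ ℚ.< 2ℚ →
      ℚ.∣ ι (J ℤ.- I) ℚ.* seq (x m) n ℚ.- ι (b m) ∣ ℚ.< ε
    close m n hj hi =
      subst (λ s → ℚ.∣ s ℚ.* seq (x m) n ℚ.- ι (b m) ∣ ℚ.< ε) (sym (ι-homo-- J I))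
        (sameCell⇒close {ι Q} {ι J} {ι I} {seq (x m) n} {ι (zj m)} {ι (zi m)} {ι (b m)} {2ℚ}
          (ι-mono-< {0ℤ} {Q} (ℤ.+<+ ℕ.z<s)) (z-z m) 4≤Qε hj hi)

dirichlet : ∀ {k} (x : Vector ℝ k) {ε} → 0ℚ ℚ.< ε →
  ∃₂ λ (s : ℤ) (b : Fin k → ℤ) → 0ℤ ℤ.< s × (∀ i → fromℤ s * x i ≈[ ε ] fromℤ (b i))
dirichlet x 0<ε =
  let q , 4≤Qε = archimedean (2ℚ ℚ.+ 2ℚ) 0<ε in dirichlet-pigeonhole x q 4≤Qε

-- Reciprocals of nonzero reals.

½*p+½*p≡p : ∀ p → ½ ℚ.* p ℚ.+ ½ ℚ.* p ≡ p
½*p+½*p≡p = solve 1 (λ p → con ½ :* p :+ con ½ :* p := p) refl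

0<½*p : ∀ {p} → 0ℚ ℚ.< p → 0ℚ ℚ.< ½ ℚ.* p
0<½*p = 0<p*q (ℚ.positive⁻¹ ½)

quotient : ∀ {p q} → 0ℚ ℚ.< p → 0ℚ ℚ.< q → ∃ λ r → 0ℚ ℚ.< r × p ℚ.* r ≡ q
quotient {p} {q} 0<p 0<q = ℚ.1/ p ℚ.* q
  , 0<p*q (ℚ.positive⁻¹ (ℚ.1/ p) {{ℚ.1/pos⇒pos p}}) 0<q
  , trans (sym (ℚ.*-assoc p (ℚ.1/ p) q)) (trans (cong (ℚ._* q) (ℚ.*-inverseʳ p)) (ℚ.*-identityˡ q))
  where
  instance
    p-pos : ℚ.Positive p
    p-pos = ℚ.positive 0<p
    p-nonZero : ℚ.NonZero p
    p-nonZero = ℚ.pos⇒nonZero p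

-- This is where excluded middle enters. Beyond some `N` the terms differ by less than ε / 2, so a
-- single term there of size at least ε would keep all of them at least ε / 2 away from 0. If `x` is
-- not apart from 0, all terms beyond `N` are therefore below ε, for every ε.
≄0⇒apart : ExcludedMiddle 0ℓ → ∀ x → ¬ x ≃ 0ℝ →
  ∃ λ d → 0ℚ ℚ.< d × Eventually λ n → d ℚ.≤ ℚ.∣ seq x n ∣
≄0⇒apart em x x≄0 = decidable-stable em λ ¬apart → x≄0 λ ε 0<ε →
  let δ = ½ ℚ.* ε
      N , close = cauchy x δ (0<½*p 0<ε)
  in N , λ n N≤n → decidable-stable (ℚ.∣ seq x n ℚ.- 0ℚ ∣ ℚ.<? ε) λ ≮ε →
    ¬apart (δ , 0<½*p 0<ε , N , λ m N≤m → begin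
      δ
        ≡⟨ solve 1 (λ d → d := (:- d) :+ (d :+ d)) refl δ ⟩
      (ℚ.- δ) ℚ.+ (δ ℚ.+ δ)
        ≡⟨ cong (λ e → (ℚ.- δ) ℚ.+ e) (½*p+½*p≡p ε) ⟩
      (ℚ.- δ) ℚ.+ ε
        ≤⟨ ℚ.+-monoʳ-≤ (ℚ.- δ) (ℚ.≮⇒≥ ≮ε) ⟩
      (ℚ.- δ) ℚ.+ ℚ.∣ seq x n ℚ.- 0ℚ ∣
        ≡⟨ cong (λ p → (ℚ.- δ) ℚ.+ ℚ.∣ p ∣)
             (solve 2 (λ p q → p :- con 0ℚ := (p :- q) :+ q) refl (seq x n) (seq x m)) ⟩
      (ℚ.- δ) ℚ.+ ℚ.∣ (seq x n ℚ.- seq x m) ℚ.+ seq x m ∣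
        ≤⟨ ℚ.+-monoʳ-≤ (ℚ.- δ) (ℚ.∣p+q∣≤∣p∣+∣q∣ (seq x n ℚ.- seq x m) (seq x m)) ⟩
      (ℚ.- δ) ℚ.+ (ℚ.∣ seq x n ℚ.- seq x m ∣ ℚ.+ ℚ.∣ seq x m ∣)
        ≤⟨ ℚ.+-monoʳ-≤ (ℚ.- δ) (ℚ.+-monoˡ-≤ ℚ.∣ seq x m ∣ (ℚ.<⇒≤ (close n m N≤n N≤m))) ⟩
      (ℚ.- δ) ℚ.+ (δ ℚ.+ ℚ.∣ seq x m ∣)
        ≡⟨ solve 2 (λ d p → (:- d) :+ (d :+ p) := p) refl δ ℚ.∣ seq x m ∣ ⟩
      ℚ.∣ seq x m ∣ ∎)
  where open ℚ.≤-Reasoning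

-- The junk value 0 at 0 only affects finitely many terms of a sequence that stays away from 0.
reciprocal : ℚ → ℚ
reciprocal p with p ℚ.≟ 0ℚ
... | yes _   = 0ℚ
... | no  p≢0 = (ℚ.1/ p) {{ℚ.≢-nonZero p≢0}}

*-reciprocal : ∀ {p} → p ≢ 0ℚ → p ℚ.* reciprocal p ≡ 1ℚ
*-reciprocal {p} p≢0 with p ℚ.≟ 0ℚ
... | yes p≡0  = contradiction p≡0 p≢0
... | no  p≢0′ = ℚ.*-inverseʳ p {{ℚ.≢-nonZero p≢0′}}

-- The inverse is taken term by term, so the product is eventually equal to 1 exactly and not merely
-- up to `_≃_`. Later identities using 1 / ξ₀ can then be proved by rational algebra at each large
-- index.
apart⇒invertible : ∀ x {d} → 0ℚ ℚ.< d → Eventually (λ n → d ℚ.≤ ℚ.∣ seq x n ∣) →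
  ∃ λ w → Eventually λ n → seq x n ℚ.* seq w n ≡ 1ℚ
apart⇒invertible x {d} 0<d (K , away) = mkℝ w w-cauchy , K , λ n K≤n → x*w≡1 (away n K≤n)
  where
  open ℚ.≤-Reasoning

  w : ℕ → ℚ
  w n = reciprocal (seq x n)

  x*w≡1 : ∀ {n} → d ℚ.≤ ℚ.∣ seq x n ∣ → seq x n ℚ.* w n ≡ 1ℚ
  x*w≡1 d≤∣x∣ = *-reciprocal λ x≡0 →
    ℚ.<-irrefl refl (ℚ.<-≤-trans 0<d (subst (λ p → d ℚ.≤ ℚ.∣ p ∣) x≡0 d≤∣x∣))

  -- This is ∣1/a - 1/b∣ = ∣b - a∣ / ∣a b∣ cleared of denominators, with ∣a b∣ ≥ d². It explains the
  -- tolerance d² ε asked of `x` in `w-cauchy`.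
  rescaled : ∀ {a b v w} → d ℚ.≤ ℚ.∣ a ∣ → d ℚ.≤ ℚ.∣ b ∣ → a ℚ.* v ≡ 1ℚ → b ℚ.* w ≡ 1ℚ →
    d ℚ.* d ℚ.* ℚ.∣ v ℚ.- w ∣ ℚ.≤ ℚ.∣ b ℚ.- a ∣
  rescaled {a} {b} {v} {w} d≤a d≤b av≡1 bw≡1 = begin
    d ℚ.* d ℚ.* ℚ.∣ v ℚ.- w ∣
      ≤⟨ ℚ.*-monoʳ-≤-nonNeg ℚ.∣ v ℚ.- w ∣ {{ℚ.∣-∣-nonNeg (v ℚ.- w)}} d*d≤ ⟩
    ℚ.∣ a ℚ.* b ∣ ℚ.* ℚ.∣ v ℚ.- w ∣
      ≡⟨ ℚ.∣p*q∣≡∣p∣*∣q∣ (a ℚ.* b) (v ℚ.- w) ⟨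
    ℚ.∣ a ℚ.* b ℚ.* (v ℚ.- w) ∣
      ≡⟨ cong ℚ.∣_∣ (solve 4 (λ a b v w → a :* b :* (v :- w) := (a :* v) :* b :- (b :* w) :* a)
           refl a b v w) ⟩
    ℚ.∣ (a ℚ.* v) ℚ.* b ℚ.- (b ℚ.* w) ℚ.* a ∣
      ≡⟨ cong₂ (λ p q → ℚ.∣ p ℚ.* b ℚ.- q ℚ.* a ∣) av≡1 bw≡1 ⟩
    ℚ.∣ 1ℚ ℚ.* b ℚ.- 1ℚ ℚ.* a ∣
      ≡⟨ cong₂ (λ p q → ℚ.∣ p ℚ.- q ∣) (ℚ.*-identityˡ b) (ℚ.*-identityˡ a) ⟩
    ℚ.∣ b ℚ.- a ∣ ∎
    where
    d*d≤ : d ℚ.* d ℚ.≤ ℚ.∣ a ℚ.* b ∣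
    d*d≤ = begin
      d ℚ.* d               ≤⟨ ℚ.*-monoʳ-≤-nonNeg d {{ℚ.nonNegative (ℚ.<⇒≤ 0<d)}} d≤a ⟩
      ℚ.∣ a ∣ ℚ.* d         ≤⟨ ℚ.*-monoˡ-≤-nonNeg ℚ.∣ a ∣ {{ℚ.∣-∣-nonNeg a}} d≤b ⟩
      ℚ.∣ a ∣ ℚ.* ℚ.∣ b ∣   ≡⟨ ℚ.∣p*q∣≡∣p∣*∣q∣ a b ⟨
      ℚ.∣ a ℚ.* b ∣         ∎

  w-cauchy : IsCauchy w
  w-cauchy ε 0<ε =
    let 0<d*d = 0<p*q 0<d 0<d
        N , close = cauchy x (d ℚ.* d ℚ.* ε) (0<p*q 0<d*d 0<ε)
    in K ℕ.⊔ N , λ m n m≥ n≥ →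
      let d≤xₘ = away m (ℕ.m⊔n≤o⇒m≤o K N m≥)
          d≤xₙ = away n (ℕ.m⊔n≤o⇒m≤o K N n≥)
      in ℚ.*-cancelˡ-<-nonNeg (d ℚ.* d) {{ℚ.nonNegative (ℚ.<⇒≤ 0<d*d)}}
        (ℚ.≤-<-trans (rescaled d≤xₘ d≤xₙ (x*w≡1 d≤xₘ) (x*w≡1 d≤xₙ))
          (close n m (ℕ.m⊔n≤o⇒n≤o K N n≥) (ℕ.m⊔n≤o⇒n≤o K N m≥)))

-- Integer relations and independence of the remainders.

*-≃0 : ∀ x y → y ≃ 0ℝ → x * y ≃ 0ℝ
*-≃0 x y y≃0 ε 0<ε with q , x≈q ← approximate x (ℚ.positive⁻¹ 1ℚ) =
  let B = 1ℚ ℚ.+ ℚ.∣ q ∣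
      δ , 0<δ , Bδ≡ε = quotient (ℚ.+-mono-<-≤ (ℚ.positive⁻¹ 1ℚ) (ℚ.0≤∣p∣ q)) 0<ε
  in map₂ (λ n hx hy → begin-strict
      ℚ.∣ seq x n ℚ.* seq y n ℚ.- 0ℚ ∣
        ≡⟨ cong ℚ.∣_∣ (solve 3 (λ x y q → x :* y :- con 0ℚ := ((x :- q) :+ q) :* (y :- con 0ℚ))
             refl (seq x n) (seq y n) q) ⟩
      ℚ.∣ ((seq x n ℚ.- q) ℚ.+ q) ℚ.* (seq y n ℚ.- 0ℚ) ∣
        <⟨ ∣*∣-mono-<
             (ℚ.≤-<-trans (ℚ.∣p+q∣≤∣p∣+∣q∣ (seq x n ℚ.- q) q) (ℚ.+-monoˡ-< ℚ.∣ q ∣ hx)) hy ⟩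
      B ℚ.* δ
        ≡⟨ Bδ≡ε ⟩
      ε ∎) x≈q (y≃0 δ 0<δ)
  where open ℚ.≤-Reasoning

multiple-≃0 : ∀ x y z → y ≃ 0ℝ → Eventually (λ n → seq x n ℚ.* seq y n ≡ seq z n) → z ≃ 0ℝ
multiple-≃0 x y z y≃0 xy≡z ε 0<ε =
  map₂ (λ n → subst (λ p → ℚ.∣ p ℚ.- 0ℚ ∣ ℚ.< ε)) xy≡z (*-≃0 x y y≃0 ε 0<ε)

Σ : ∀ {k} → Vector ℚ k → ℚ
Σ = Vector.foldr ℚ._+_ 0ℚ

seq-sum : ∀ {k} (x : Vector ℝ k) n → seq (sum x) n ≡ Σ (λ i → seq (x i) n)
seq-sum {ℕ.zero} x n = refl
seq-sum {suc k}  x n = cong (seq (x Fin.zero) n ℚ.+_) (seq-sum (x ∘ Fin.suc) n)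

Σ-0* : ∀ {k} (y : Vector ℚ k) → Σ (λ i → ι 0ℤ ℚ.* y i) ≡ 0ℚ
Σ-0* {ℕ.zero} y = refl
Σ-0* {suc k}  y = trans
  (cong₂ ℚ._+_ (ℚ.*-zeroˡ (y Fin.zero)) (Σ-0* (y ∘ Fin.suc))) (ℚ.+-identityʳ 0ℚ)

-- A vanishing head would give the relation with coefficients 1, 0, ..., 0. This is what permits
-- division by ξ₀.
independent⇒head≄0 : ∀ {k} (ξ : Vector ℝ (suc k)) → RationallyIndependent ξ → ¬ ξ Fin.zero ≃ 0ℝ
independent⇒head≄0 ξ indep ξ₀≃0 = indep (c , (λ c≡0 → contradiction (c≡0 Fin.zero) λ ()) , c⊥ξ)
  where
  c = 1ℤ Vector.∷ λ _ → 0ℤ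
  eq : ∀ n → seq (sum (λ i → fromℤ (c i) * ξ i)) n ≡ seq (ξ Fin.zero) n
  eq n = trans (seq-sum (λ i → fromℤ (c i) * ξ i) n) (trans
    (cong₂ ℚ._+_ (ℚ.*-identityˡ (seq (ξ Fin.zero) n)) (Σ-0* (λ i → seq (ξ (Fin.suc i)) n)))
    (ℚ.+-identityʳ (seq (ξ Fin.zero) n)))
  c⊥ξ : sum (λ i → fromℤ (c i) * ξ i) ≃ 0ℝ
  c⊥ξ ε 0<ε = let N , h = ξ₀≃0 ε 0<ε in
    N , λ n N≤n → subst (λ p → ℚ.∣ p ℚ.- 0ℚ ∣ ℚ.< ε) (sym (eq n)) (h n N≤n)

remainders : ∀ {k} → ℝ → ℤ → Vector ℤ k → Vector ℝ k → Vector ℝ k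
remainders w s b ξ i = fromℤ s * (ξ i * w) + fromℤ (ℤ.- b i)

-- With x = ξ₀, w = 1 / ξ₀ and ψᵢ = s ξᵢ w − bᵢ, the combination x · Σ cᵢ ψᵢ has coefficient
-- − Σ cᵢ bᵢ at ξ₀ and s cᵢ at ξᵢ.
headCoefficient : ∀ {k} → Vector ℤ k → Vector ℤ k → ℤ
headCoefficient c b = Vector.foldr ℤ._+_ 0ℤ λ i → c i ℤ.* ℤ.- b i

-- By x w = 1, each summand satisfies x c (s y w - b) = (- c b) x + c s y. The recursion collects
-- the multiples of `x` into the head coefficient.
x*Σ-remainders : ∀ {k} {x w} s (b c : Vector ℤ k) (y : Vector ℚ k) → x ℚ.* w ≡ 1ℚ →
  x ℚ.* Σ (λ i → ι (c i) ℚ.* (ι s ℚ.* (y i ℚ.* w) ℚ.+ ι (ℤ.- b i))) ≡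
  ι (headCoefficient c b) ℚ.* x ℚ.+ Σ (λ i → ι (c i ℤ.* s) ℚ.* y i)
x*Σ-remainders {ℕ.zero} {x} s b c y xw≡1 =
  solve 1 (λ x → x :* con 0ℚ := con 0ℚ :* x :+ con 0ℚ) refl x
x*Σ-remainders {suc k} {x} {w} s b c y xw≡1 = begin
  x ℚ.* (ι c₀ ℚ.* (ι s ℚ.* (y₀ ℚ.* w) ℚ.+ ι (ℤ.- b₀)) ℚ.+ R)
    ≡⟨ solve 7 (λ x c s y w b r →
         x :* (c :* (s :* (y :* w) :+ b) :+ r) := c :* b :* x :+ (x :* w :* (c :* s :* y) :+ x :* r))
         refl x (ι c₀) (ι s) y₀ w (ι (ℤ.- b₀)) R ⟩
  ι c₀ ℚ.* ι (ℤ.- b₀) ℚ.* x ℚ.+ (x ℚ.* w ℚ.* (ι c₀ ℚ.* ι s ℚ.* y₀) ℚ.+ x ℚ.* R)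
    ≡⟨ cong₂ (λ p q → ι c₀ ℚ.* ι (ℤ.- b₀) ℚ.* x ℚ.+ (p ℚ.* (ι c₀ ℚ.* ι s ℚ.* y₀) ℚ.+ q)) xw≡1
         (x*Σ-remainders s (b ∘ Fin.suc) (c ∘ Fin.suc) (y ∘ Fin.suc) xw≡1) ⟩
  ι c₀ ℚ.* ι (ℤ.- b₀) ℚ.* x ℚ.+ (1ℚ ℚ.* (ι c₀ ℚ.* ι s ℚ.* y₀) ℚ.+ (ι e ℚ.* x ℚ.+ L))
    ≡⟨ solve 5 (λ p x q e l →
         p :* x :+ (con 1ℚ :* q :+ (e :* x :+ l)) := (p :+ e) :* x :+ (q :+ l))
         refl (ι c₀ ℚ.* ι (ℤ.- b₀)) x (ι c₀ ℚ.* ι s ℚ.* y₀) (ι e) L ⟩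
  (ι c₀ ℚ.* ι (ℤ.- b₀) ℚ.+ ι e) ℚ.* x ℚ.+ (ι c₀ ℚ.* ι s ℚ.* y₀ ℚ.+ L)
    ≡⟨ cong₂ (λ p q → p ℚ.* x ℚ.+ (q ℚ.* y₀ ℚ.+ L))
         (trans (ι-homo-+ (c₀ ℤ.* ℤ.- b₀) e) (cong (ℚ._+ ι e) (ι-homo-* c₀ (ℤ.- b₀))))
         (ι-homo-* c₀ s) ⟨
  ι (c₀ ℤ.* ℤ.- b₀ ℤ.+ e) ℚ.* x ℚ.+ (ι (c₀ ℤ.* s) ℚ.* y₀ ℚ.+ L) ∎
  where
  open ≡-Reasoning
  c₀ = c Fin.zero
  b₀ = b Fin.zero
  y₀ = y Fin.zero
  e  = headCoefficient (c ∘ Fin.suc) (b ∘ Fin.suc)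
  R  = Σ (λ i → ι (c (Fin.suc i)) ℚ.* (ι s ℚ.* (y (Fin.suc i) ℚ.* w) ℚ.+ ι (ℤ.- b (Fin.suc i))))
  L  = Σ (λ i → ι (c (Fin.suc i) ℤ.* s) ℚ.* y (Fin.suc i))

-- Multiplying a relation `c` among the `ψ` by `x` gives the relation `f c` among the `ξ`, which is
-- still nontrivial because `f` reflects zero.
independence-transfer : ∀ {k l} (ξ : Vector ℝ k) (ψ : Vector ℝ l) x (f : Vector ℤ l → Vector ℤ k) →
  (∀ c → (∀ i → f c i ≡ 0ℤ) → ∀ i → c i ≡ 0ℤ) →
  Eventually (λ n → ∀ c →
    seq x n ℚ.* Σ (λ i → ι (c i) ℚ.* seq (ψ i) n) ≡ Σ (λ i → ι (f c i) ℚ.* seq (ξ i) n)) →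
  RationallyIndependent ξ → RationallyIndependent ψ
independence-transfer ξ ψ x f f-reflects-0 xΣ≡Σ indep (c , c≢0 , c⊥ψ) =
  indep (f c , (λ fc≡0 → c≢0 (f-reflects-0 c fc≡0)) ,
    multiple-≃0 x (sum λ i → fromℤ (c i) * ψ i) (sum λ i → fromℤ (f c i) * ξ i) c⊥ψ (map eq xΣ≡Σ))
  where
  eq : ∀ n →
    (∀ c → seq x n ℚ.* Σ (λ i → ι (c i) ℚ.* seq (ψ i) n) ≡ Σ (λ i → ι (f c i) ℚ.* seq (ξ i) n)) →
    seq x n ℚ.* seq (sum λ i → fromℤ (c i) * ψ i) n ≡ seq (sum λ i → fromℤ (f c i) * ξ i) n
  eq n h = begin
    seq x n ℚ.* seq (sum λ i → fromℤ (c i) * ψ i) n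
      ≡⟨ cong (seq x n ℚ.*_) (seq-sum (λ i → fromℤ (c i) * ψ i) n) ⟩
    seq x n ℚ.* Σ (λ i → ι (c i) ℚ.* seq (ψ i) n)
      ≡⟨ h c ⟩
    Σ (λ i → ι (f c i) ℚ.* seq (ξ i) n)
      ≡⟨ seq-sum (λ i → fromℤ (f c i) * ξ i) n ⟨
    seq (sum λ i → fromℤ (f c i) * ξ i) n ∎
    where open ≡-Reasoning

-- The new relation has tail coefficients cᵢ s, and `s` is positive, so their vanishing already
-- forces every cᵢ to vanish.
remainders-independent : ∀ {k} (ξ : Vector ℝ (suc k)) w s b → 0ℤ ℤ.< s →
  Eventually (λ n → seq (ξ Fin.zero) n ℚ.* seq w n ≡ 1ℚ) →
  RationallyIndependent ξ → RationallyIndependent (remainders w s b (λ i → ξ (Fin.suc i)))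
remainders-independent ξ w s b 0<s xw≡1 = independence-transfer
  ξ (remainders w s b (λ i → ξ (Fin.suc i))) (ξ Fin.zero)
  (λ c → headCoefficient c b Vector.∷ (λ i → c i ℤ.* s))
  (λ c cs≡0 i → ℤ.*-cancelʳ-≡ (c i) 0ℤ s {{ℤ.>-nonZero 0<s}} (cs≡0 (Fin.suc i)))
  (map (λ n h c → x*Σ-remainders s b c (λ i → seq (ξ (Fin.suc i)) n) h) xw≡1)

-- The induction for Kronecker's theorem.

infix 8 -_

-- As a product with a constant it inherits the Cauchy proof of `_*_`; this is the origin of the
-- factors `ℚ.- 1ℚ` in the identities below.
-_ : ℝ → ℝ
- x = fromℚ (ℚ.- 1ℚ) * x

errorAtHead : ∀ x w a u → x ℚ.* w ≡ 1ℚ → x ℚ.* ((u ℚ.+ a) ℚ.* w) ℚ.- (a ℚ.+ u) ≡ 0ℚ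
errorAtHead x w a u xw≡1 = begin
  x ℚ.* ((u ℚ.+ a) ℚ.* w) ℚ.- (a ℚ.+ u)
    ≡⟨ solve 4 (λ x w a u → x :* ((u :+ a) :* w) :- (a :+ u) := (x :* w) :* (u :+ a) :- (a :+ u))
         refl x w a u ⟩
  (x ℚ.* w) ℚ.* (u ℚ.+ a) ℚ.- (a ℚ.+ u)
    ≡⟨ cong (λ p → p ℚ.* (u ℚ.+ a) ℚ.- (a ℚ.+ u)) xw≡1 ⟩
  1ℚ ℚ.* (u ℚ.+ a) ℚ.- (a ℚ.+ u)
    ≡⟨ solve 2 (λ a u → con 1ℚ :* (u :+ a) :- (a :+ u) := con 0ℚ) refl a u ⟩
  0ℚ ∎
  where open ≡-Reasoning

-- Writing s y w = ψ + b, the position is m ψ + m b + a₀ y w, and m ψ = ψ t - ψ (t - m). The integer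
-- m b joins the shift, a₀ y w joins the target of ψ, and what remains is the error of ψ at time `t`
-- minus the cost of rounding `t` to `m`.
errorAtTail : ∀ s b m c a₀ a y w t →
  let ψ = ι s ℚ.* (y ℚ.* w) ℚ.+ ι (ℤ.- b) in
  y ℚ.* ((ι (m ℤ.* s) ℚ.+ a₀) ℚ.* w) ℚ.- (a ℚ.+ ι (m ℤ.* b ℤ.+ c)) ≡
  (ψ ℚ.* t ℚ.- ((a ℚ.+ ℚ.- 1ℚ ℚ.* (a₀ ℚ.* (y ℚ.* w))) ℚ.+ ι c)) ℚ.-
  (ι s ℚ.* (y ℚ.* w) ℚ.- ι b) ℚ.* (t ℚ.- ι m)
errorAtTail s b m c a₀ a y w t = begin
  y ℚ.* ((ι (m ℤ.* s) ℚ.+ a₀) ℚ.* w) ℚ.- (a ℚ.+ ι (m ℤ.* b ℤ.+ c))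
    ≡⟨ cong₂ (λ p q → y ℚ.* ((p ℚ.+ a₀) ℚ.* w) ℚ.- (a ℚ.+ q)) (ι-homo-* m s)
         (trans (ι-homo-+ (m ℤ.* b) c) (cong (ℚ._+ ι c) (ι-homo-* m b))) ⟩
  y ℚ.* ((ι m ℚ.* ι s ℚ.+ a₀) ℚ.* w) ℚ.- (a ℚ.+ (ι m ℚ.* ι b ℚ.+ ι c))
    ≡⟨ solve 9 (λ s b m c a₀ a y w t →
         y :* ((m :* s :+ a₀) :* w) :- (a :+ (m :* b :+ c)) :=
         ((s :* (y :* w) :+ (:- b)) :* t :- ((a :+ con (ℚ.- 1ℚ) :* (a₀ :* (y :* w))) :+ c)) :-
         (s :* (y :* w) :- b) :* (t :- m))
         refl (ι s) (ι b) (ι m) (ι c) a₀ a y w t ⟩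
  ((ι s ℚ.* (y ℚ.* w) ℚ.+ (ℚ.- ι b)) ℚ.* t ℚ.- ((a ℚ.+ ℚ.- 1ℚ ℚ.* (a₀ ℚ.* (y ℚ.* w))) ℚ.+ ι c)) ℚ.-
  (ι s ℚ.* (y ℚ.* w) ℚ.- ι b) ℚ.* (t ℚ.- ι m)
    ≡⟨ cong (λ p →
         ((ι s ℚ.* (y ℚ.* w) ℚ.+ p) ℚ.* t ℚ.- ((a ℚ.+ ℚ.- 1ℚ ℚ.* (a₀ ℚ.* (y ℚ.* w))) ℚ.+ ι c)) ℚ.-
         (ι s ℚ.* (y ℚ.* w) ℚ.- ι b) ℚ.* (t ℚ.- ι m)) (ι-homo-neg b) ⟨
  _ ∎
  where open ≡-Reasoning

-- At time (m s + α₀) / ξ₀ the head coordinate is exactly on target; replacing t by m costs the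
-- other ones at most 2 (ε / 4).
kronecker-lift : ∀ {k} (ξ α : Vector ℝ (suc k)) w s (b c : Vector ℤ k) m t {ε} → 0ℚ ℚ.< ε →
  Eventually (λ n → seq (ξ Fin.zero) n ℚ.* seq w n ≡ 1ℚ) →
  (∀ i → fromℤ s * (ξ (Fin.suc i) * w) ≈[ ½ ℚ.* (½ ℚ.* ε) ] fromℤ (b i)) →
  (∀ i → remainders w s b (λ i → ξ (Fin.suc i)) i * t ≈[ ½ ℚ.* ε ]
         (α (Fin.suc i) + - (α Fin.zero * (ξ (Fin.suc i) * w))) + fromℤ (c i)) →
  t ≈[ 2ℚ ] fromℤ m →
  ∃₂ λ t (p : Vector ℤ (suc k)) → ∀ i → ξ i * t ≈[ ε ] α i + fromℤ (p i)
kronecker-lift {k} ξ α w s b c m t {ε} 0<ε xw≡1 sϑ≈b ψt≈ t≈m = time , p , ξtime≈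
  where
  time = (fromℤ (m ℤ.* s) + α Fin.zero) * w

  p : Vector ℤ (suc k)
  p = (m ℤ.* s) Vector.∷ λ i → m ℤ.* b i ℤ.+ c i

  module _ (i : Fin k) (n : ℕ) where
    y a₀ a ψ target : ℚ
    y      = seq (ξ (Fin.suc i)) n
    a₀     = seq (α Fin.zero) n
    a      = seq (α (Fin.suc i)) n
    ψ      = ι s ℚ.* (y ℚ.* seq w n) ℚ.+ ι (ℤ.- b i)
    target = a ℚ.+ ℚ.- 1ℚ ℚ.* (a₀ ℚ.* (y ℚ.* seq w n)) ℚ.+ ι (c i)

    tail-close :
      ℚ.∣ ψ ℚ.* seq t n ℚ.- target ∣ ℚ.< ½ ℚ.* ε →
      ℚ.∣ (ι s ℚ.* (y ℚ.* seq w n) ℚ.- ι (b i)) ℚ.* (seq t n ℚ.- ι m) ∣ ℚ.< ½ ℚ.* (½ ℚ.* ε) ℚ.* 2ℚ →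
      ℚ.∣ y ℚ.* ((ι (m ℤ.* s) ℚ.+ a₀) ℚ.* seq w n) ℚ.- (a ℚ.+ ι (m ℤ.* b i ℤ.+ c i)) ∣ ℚ.< ε
    tail-close h₁ h₂ = subst₂ (λ p q → ℚ.∣ p ∣ ℚ.< q)
      (sym (errorAtTail s (b i) m (c i) a₀ a y (seq w n) (seq t n)))
      (solve 1 (λ e → con ½ :* e :+ con ½ :* (con ½ :* e) :* con 2ℚ := e) refl ε)
      (∣-∣-mono-< h₁ h₂)

  ξtime≈ : ∀ i → ξ i * time ≈[ ε ] α i + fromℤ (p i)
  ξtime≈ Fin.zero = let N , xw = xw≡1 in N , λ n N≤n → subst (λ p → ℚ.∣ p ∣ ℚ.< ε)
    (sym (errorAtHead (seq (ξ Fin.zero) n) (seq w n) (seq (α Fin.zero) n) (ι (m ℤ.* s)) (xw n N≤n)))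
    0<ε
  ξtime≈ (Fin.suc i) = map₂ (tail-close i) (ψt≈ i) (map₂ (λ n → ∣*∣-mono-<) (sϑ≈b i) t≈m)

-- The sign and size of `t` are left open here; `kronecker-after` controls them.
kronecker : ExcludedMiddle 0ℓ → ∀ {k} (ξ : Vector ℝ k) → RationallyIndependent ξ →
  ∀ (α : Vector ℝ k) {ε} → 0ℚ ℚ.< ε →
  ∃₂ λ t (p : Vector ℤ k) → ∀ i → ξ i * t ≈[ ε ] α i + fromℤ (p i)
kronecker em {ℕ.zero} ξ indep α 0<ε = 0ℝ , (λ ()) , λ ()
kronecker em {suc k}  ξ indep α {ε} 0<ε =
  let d , 0<d , d≤∣x∣ = ≄0⇒apart em (ξ Fin.zero) (independent⇒head≄0 ξ indep)
      w , xw≡1 = apart⇒invertible (ξ Fin.zero) 0<d d≤∣x∣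
      -- The remainders must be fixed before `t` is known. A tolerance of ε / 4 can be chosen now
      -- because the rounding distance from `t` to `m` is below 2 however large `t` is; the other ε
      -- / 2 goes to the induction hypothesis.
      s , b , 0<s , sϑ≈b = dirichlet (λ i → ξ (Fin.suc i) * w) (0<½*p (0<½*p 0<ε))
      t , c , ψt≈ = kronecker em (remainders w s b (λ i → ξ (Fin.suc i)))
        (remainders-independent ξ w s b 0<s xw≡1 indep)
        (λ i → α (Fin.suc i) + - (α Fin.zero * (ξ (Fin.suc i) * w))) (0<½*p 0<ε)
      m , t≈m = nearbyInteger t
  in kronecker-lift ξ α w s b c m t 0<ε xw≡1 sϑ≈b ψt≈ t≈m

-- Moving the meeting time beyond a given bound.

0<i⇒p≤ι*p : ∀ {i p} → 0ℤ ℤ.< i → 0ℚ ℚ.≤ p → p ℚ.≤ ι i ℚ.* p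
0<i⇒p≤ι*p {i} {p} 0<i 0≤p = begin
  p              ≡⟨ ℚ.*-identityˡ p ⟨
  1ℚ ℚ.* p       ≤⟨ ℚ.*-monoʳ-≤-nonNeg p {{ℚ.nonNegative 0≤p}}
                      (ι-mono-≤ {1ℤ} {i} (ℤ.i<j⇒suc[i]≤j 0<i)) ⟩
  ι i ℚ.* p      ∎
  where open ℚ.≤-Reasoning

+-≈ : ∀ x t u a p b {δ ε} → x * t ≈[ δ ] a + fromℤ p → u * x ≈[ ε ] fromℤ b →
  x * (t + u) ≈[ δ ℚ.+ ε ] a + fromℤ (p ℤ.+ b)
+-≈ x t u a p b {δ} {ε} = map₂ λ n h₁ h₂ → subst (λ q → ℚ.∣ q ∣ ℚ.< δ ℚ.+ ε)
  (trans (solve 6 (λ x t u a p b →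
      (x :* t :- (a :+ p)) :+ (u :* x :- b) := x :* (t :+ u) :- (a :+ (p :+ b))) refl
      (seq x n) (seq t n) (seq u n) (seq a n) (ι p) (ι b))
    (cong (λ q → seq x n ℚ.* (seq t n ℚ.+ seq u n) ℚ.- (seq a n ℚ.+ q)) (sym (ι-homo-+ p b))))
  (∣+∣-mono-< h₁ h₂)

-- Since t > q - 1, the constant 2 in the gap covers this loss of 1 and the margin of 1 by which `T`
-- is exceeded.
surpass : ∀ B q T t {p s} → T ℚ.≤ B → ℚ.∣ t ℚ.- q ∣ ℚ.< 1ℚ →
  B ℚ.+ 2ℚ ℚ.- q ℚ.≤ p → p ℚ.≤ s → T ℚ.+ 1ℚ ℚ.≤ t ℚ.+ s
surpass B q T t {p} {s} T≤B t≈q gap≤p p≤s = begin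
  T ℚ.+ 1ℚ
    ≤⟨ ℚ.+-monoˡ-≤ 1ℚ T≤B ⟩
  B ℚ.+ 1ℚ
    ≡⟨ solve 2 (λ b q → b :+ con 1ℚ := q :+ (b :+ con 2ℚ :- q) :- con 1ℚ) refl B q ⟩
  q ℚ.+ (B ℚ.+ 2ℚ ℚ.- q) ℚ.- 1ℚ
    ≤⟨ ℚ.+-monoˡ-≤ (ℚ.- 1ℚ) (ℚ.+-mono-≤ (ℚ.<⇒≤ (∣p-q∣<r⇒q<p+r t q t≈q)) (ℚ.≤-trans gap≤p p≤s)) ⟩
  t ℚ.+ 1ℚ ℚ.+ s ℚ.- 1ℚ
    ≡⟨ solve 2 (λ t s → t :+ con 1ℚ :+ s :- con 1ℚ := t :+ s) refl t s ⟩
  t ℚ.+ s ∎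
  where open ℚ.≤-Reasoning

-- `M` is chosen before `s` and works for every positive `s`, since Dirichlet's theorem, applied
-- afterwards to the speeds multiplied by M + 1, controls only the sign of `s`.
reachable : ∀ T t → ∃ λ (M : ℕ) → ∀ s → 0ℤ ℤ.< s → T < t + fromℤ s * fromℤ (ℤ.+ suc M)
reachable T t =
  let B , T≤B = bounded-above T
      q , t≈q = approximate t (ℚ.positive⁻¹ 1ℚ)
      M , gap≤ = archimedean (B ℚ.+ 2ℚ ℚ.- q) (ℚ.positive⁻¹ 1ℚ)
      gap≤M = ℚ.≤-trans gap≤ (ℚ.≤-reflexive (ℚ.*-identityʳ (ι (ℤ.+ suc M))))
      0≤M = ι-mono-≤ {0ℤ} {ℤ.+ suc M} (ℤ.+≤+ ℕ.z≤n)
  in M , λ s 0<s → 1ℚ , ℚ.positive⁻¹ 1ℚ ,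
     map₂ (λ n T≤B t≈q → surpass B q (seq T n) (seq t n) T≤B t≈q gap≤M (0<i⇒p≤ι*p 0<s 0≤M)) T≤B t≈q

*-assoc-≈ : ∀ x y z b {ε} → x * (y * z) ≈[ ε ] b → x * y * z ≈[ ε ] b
*-assoc-≈ x y z b {ε} = map λ n → subst (λ q → ℚ.∣ q ℚ.- seq b n ∣ ℚ.< ε)
  (sym (ℚ.*-assoc (seq x n) (seq y n) (seq z n)))

kronecker-after : ExcludedMiddle 0ℓ → ∀ {k} (ξ : Vector ℝ k) → RationallyIndependent ξ →
  ∀ (α : Vector ℝ k) T {ε} → 0ℚ ℚ.< ε →
  ∃₂ λ t (p : Vector ℤ k) → T < t × (∀ i → ξ i * t ≈[ ε ] α i + fromℤ (p i))
kronecker-after em ξ indep α T {ε} 0<ε =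
  let t , p , ξt≈ = kronecker em ξ indep α (0<½*p 0<ε)
      M , T<      = reachable T t
      -- The speeds are scaled by M + 1 so that s (M + 1) is an approximate return time that is at
      -- least M + 1.
      s , b , 0<s , sMξ≈b = dirichlet (λ i → fromℤ (ℤ.+ suc M) * ξ i) (0<½*p 0<ε)
      u = fromℤ s * fromℤ (ℤ.+ suc M)
  in t + u , (λ i → p i ℤ.+ b i) , T< s 0<s
   , λ i → subst (λ δ → ξ i * (t + u) ≈[ δ ] α i + fromℤ (p i ℤ.+ b i)) (½*p+½*p≡p ε)
       (+-≈ (ξ i) t u (α i) (p i) (b i) (ξt≈ i)
         (*-assoc-≈ (fromℤ s) (fromℤ (ℤ.+ suc M)) (ξ i) (fromℤ (b i)) (sMξ≈b i)))

-- Targets inside an arc.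

<⇒≤ : ∀ x y → x < y → x ≤ y
<⇒≤ x y (δ , 0<δ , M , x+δ≤y) (ε , 0<ε , N , y+ε≤x) =
  ℚ.<-irrefl refl (begin-strict
    X                  ≡⟨ ℚ.+-identityʳ X ⟨
    X ℚ.+ 0ℚ           <⟨ ℚ.+-monoʳ-< X 0<δ ⟩
    X ℚ.+ δ            ≤⟨ x+δ≤y n (ℕ.m≤m⊔n M N) ⟩
    Y                  ≡⟨ ℚ.+-identityʳ Y ⟨
    Y ℚ.+ 0ℚ           <⟨ ℚ.+-monoʳ-< Y 0<ε ⟩
    Y ℚ.+ ε            ≤⟨ y+ε≤x n (ℕ.m≤n⊔m M N) ⟩
    X                  ∎)
  where
  open ℚ.≤-Reasoning
  n = M ℕ.⊔ N
  X = seq x n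
  Y = seq y n

<⇒bound : ∀ closed x y → x < y → bound closed x y
<⇒bound true  x y x<y = <⇒≤ x y x<y
<⇒bound false x y x<y = x<y

-- With `q` within δ of `l` and the target at q + 3 δ, a point `x` within δ of the target satisfies
-- l + δ < x and x < l + 5 δ. One more δ of margin below `u` makes six in all.
6ℚ : ℚ
6ℚ = ℤ.+ 6 ℚ./ 1

above : ∀ l q x {δ} → ℚ.∣ l ℚ.- q ∣ ℚ.< δ → ℚ.∣ x ℚ.- (q ℚ.+ (δ ℚ.+ δ ℚ.+ δ)) ∣ ℚ.< δ →
  l ℚ.+ δ ℚ.≤ x
above l q x {δ} l≈q x≈a = ℚ.<⇒≤ (begin-strict
  l ℚ.+ δ
    <⟨ ℚ.+-monoˡ-< δ (∣p-q∣<r⇒p<q+r l q l≈q) ⟩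
  (q ℚ.+ δ) ℚ.+ δ
    ≡⟨ solve 2 (λ q d → (q :+ d) :+ d := (q :+ (d :+ d :+ d)) :- d) refl q δ ⟩
  (q ℚ.+ (δ ℚ.+ δ ℚ.+ δ)) ℚ.- δ
    <⟨ ℚ.+-monoˡ-< (ℚ.- δ) (∣p-q∣<r⇒q<p+r x (q ℚ.+ (δ ℚ.+ δ ℚ.+ δ)) x≈a) ⟩
  (x ℚ.+ δ) ℚ.- δ
    ≡⟨ solve 2 (λ x d → (x :+ d) :- d := x) refl x δ ⟩
  x ∎)
  where open ℚ.≤-Reasoning

below : ∀ l q x u {δ} → l ℚ.+ 6ℚ ℚ.* δ ℚ.≤ u → ℚ.∣ l ℚ.- q ∣ ℚ.< δ →
  ℚ.∣ x ℚ.- (q ℚ.+ (δ ℚ.+ δ ℚ.+ δ)) ∣ ℚ.< δ → x ℚ.+ δ ℚ.≤ u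
below l q x u {δ} l+6δ≤u l≈q x≈a = ℚ.<⇒≤ (begin-strict
  x ℚ.+ δ
    <⟨ ℚ.+-monoˡ-< δ (∣p-q∣<r⇒p<q+r x (q ℚ.+ (δ ℚ.+ δ ℚ.+ δ)) x≈a) ⟩
  (q ℚ.+ (δ ℚ.+ δ ℚ.+ δ)) ℚ.+ δ ℚ.+ δ
    <⟨ ℚ.+-monoˡ-< δ (ℚ.+-monoˡ-< δ (ℚ.+-monoˡ-< (δ ℚ.+ δ ℚ.+ δ) (∣p-q∣<r⇒q<p+r l q l≈q))) ⟩
  ((l ℚ.+ δ) ℚ.+ (δ ℚ.+ δ ℚ.+ δ)) ℚ.+ δ ℚ.+ δ
    ≡⟨ solve 2 (λ l d → ((l :+ d) :+ (d :+ d :+ d)) :+ d :+ d := l :+ con 6ℚ :* d) refl l δ ⟩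
  l ℚ.+ 6ℚ ℚ.* δ
    ≤⟨ l+6δ≤u ⟩
  u ∎)
  where open ℚ.≤-Reasoning

-- Both inequalities are strict, so the point found lies in the interval whichever endpoints belong
-- to it.
between : ∀ l u → l < u → ∃₂ λ a δ → 0ℚ ℚ.< δ × (∀ x → x ≈[ δ ] fromℚ a → l < x × x < u)
between l u (ε , 0<ε , l+ε≤u) =
  let δ , 0<δ , 6δ≡ε = quotient (ℚ.positive⁻¹ 6ℚ) 0<ε
      q , l≈q = approximate l 0<δ
  in q ℚ.+ (δ ℚ.+ δ ℚ.+ δ) , δ , 0<δ , λ x x≈a →
    (δ , 0<δ , map₂ (λ n → above (seq l n) q (seq x n)) l≈q x≈a) ,
    (δ , 0<δ , map₂ (λ n l+ε≤u l∧x≈ → below (seq l n) q (seq x n) (seq u n)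
        (subst (λ p → seq l n ℚ.+ p ℚ.≤ seq u n) (sym 6δ≡ε) l+ε≤u) (proj₁ l∧x≈) (proj₂ l∧x≈))
      l+ε≤u (map₂ (λ n → _,_) l≈q x≈a))

-- Aiming ξ t at a - β modulo 1 brings the runner who started at `β` to `a`; subtracting the integer
-- `p` selects the representative that lies near `a` on the line.
position-≈ : ∀ ξ β t a p {ε} → ξ * t ≈[ ε ] (fromℚ a + - β) + fromℤ p →
  position ξ β t + fromℤ (ℤ.- p) ≈[ ε ] fromℚ a
position-≈ ξ β t a p {ε} = map λ n → subst (λ q → ℚ.∣ q ∣ ℚ.< ε) (begin
  seq ξ n ℚ.* seq t n ℚ.- ((a ℚ.+ ℚ.- 1ℚ ℚ.* seq β n) ℚ.+ ι p)
    ≡⟨ solve 4 (λ x a b p → x :- ((a :+ con (ℚ.- 1ℚ) :* b) :+ p) := ((x :+ b) :+ (:- p)) :- a) refl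
         (seq ξ n ℚ.* seq t n) a (seq β n) (ι p) ⟩
  ((seq ξ n ℚ.* seq t n ℚ.+ seq β n) ℚ.+ (ℚ.- ι p)) ℚ.- a
    ≡⟨ cong (λ q → ((seq ξ n ℚ.* seq t n ℚ.+ seq β n) ℚ.+ q) ℚ.- a) (ι-homo-neg p) ⟨
  ((seq ξ n ℚ.* seq t n ℚ.+ seq β n) ℚ.+ ι (ℤ.- p)) ℚ.- a ∎)
  where open ≡-Reasoning

≃-refl : ∀ x → x ≃ x
≃-refl x ε 0<ε = always λ n → subst (λ d → ℚ.∣ d ∣ ℚ.< ε) (sym (ℚ.+-inverseʳ (seq x n))) 0<ε

theorem4 : ExcludedMiddle 0ℓ →
    (k : ℕ) (ξ : Vector ℝ k) (β : Vector Circle k) →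
    (∀ i → 0ℝ < ξ i) →
    RationallyIndependent ξ →
    (A : Arc) (T : ℝ) → 0ℝ < T →
    ∃ λ (t : ℝ) → T < t × (∀ (i : Fin k) → position (ξ i) (β i) t ∈ A)
theorem4 em k ξ β _ indep A T _ =
  let open Arc A
      a , δ , 0<δ , inside = between lower upper length-positive
      t , p , T<t , ξt≈ = kronecker-after em ξ indep (λ i → fromℚ a + - β i) T 0<δ
  in t , T<t , λ i →
    let x = position (ξ i) (β i) t + fromℤ (ℤ.- p i)
        l<x , x<u = inside x (position-≈ (ξ i) (β i) t a (p i) (ξt≈ i))
    -- The representative `x` is by definition the position plus the integer - pᵢ, so reflexivity
    -- proves that both are the same point of the circle.
    in x , (<⇒bound lowerClosed lower x l<x , <⇒bound upperClosed x upper x<u) , ℤ.- p i , ≃-refl x
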